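{- Let $p$ be an odd prime and let $g \in \mathbb{F}_p[x]$ be a polynomial of degree at most $p-1$, regarded as a function $g\colon \mathbb{F}_p \to \mathbb{F}_p$. For $i \in \mathbb{F}_p$ let $\tilde g(i) \in \{0,1,\ldots,p-1\} \subset \mathbb{Z}$ denote the integer representative of $g(i)$. If $\sum_{i \in \mathbb{F}_p} \tilde g(i) = p$ as an equality of integers, then either the degree of $g$ is at least $\frac{p-1}{2}$ or $g$ is a constant function.
   Context: $\mathbb{F}_p$ is the field of $p$ elements. Every function $\mathbb{F}_p \to \mathbb{F}_p$ is given by a unique polynomial of degree at most $p-1$, and the degree of such a function means the degree of this polynomial. Elements of $\mathbb{F}_p$ are identified with the integers $0,1,\ldots,p-1$, and the sum of the values of $g$ is taken in $\mathbb{Z}$ (not modulo $p$). -}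

module Defs where

open import Algebra.Properties.CommutativeMonoid.Sum using (sum)
open import Data.Bool using (if_then_else_)
open import Data.Fin using (Fin; toℕ)
import Data.Fin as Fin
open import Data.List using (List; []; _∷_)
open import Data.List.Relation.Unary.All using (all?)
open import Data.Nat as ℕ using (ℕ; suc; NonZero)
open import Data.Nat.DivMod using (_mod_)
open import Data.Nat.Properties using (+-0-commutativeMonoid)
open import Data.Product using (∃-syntax)
open import Relation.Binary.PropositionalEquality using (_≡_)
open import Relation.Nullary using (does)

-- The residues modulo p, represented by the integers 0, …, p − 1;
-- for p prime this is the field of p elements.
𝔽 : ℕ → Set
𝔽 = Fin

module _ {p : ℕ} .{{_ : NonZero p}} where

  infixl 6 _+_
  infixl 7 _*_

  0# : 𝔽 p
  0# = 0 mod p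

  _+_ : 𝔽 p → 𝔽 p → 𝔽 p
  x + y = (toℕ x ℕ.+ toℕ y) mod p

  _*_ : 𝔽 p → 𝔽 p → 𝔽 p
  x * y = (toℕ x ℕ.* toℕ y) mod p

-- c₀ ∷ c₁ ∷ … ∷ cₙ ∷ [] is c₀ + c₁ x + … + cₙ xⁿ. Trailing zeros are allowed,
-- so a polynomial has many representations; degree and ⟦_⟧ do not depend on
-- which one is chosen.
Polynomial : ℕ → Set
Polynomial p = List (𝔽 p)

module _ {p : ℕ} .{{_ : NonZero p}} where

  ⟦_⟧ : Polynomial p → 𝔽 p → 𝔽 p
  ⟦ []     ⟧ x = 0#
  ⟦ c ∷ cs ⟧ x = c + x * ⟦ cs ⟧ x

  -- The largest index of a nonzero coefficient, with the convention that the
  -- zero polynomial has degree 0.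
  degree : Polynomial p → ℕ
  degree []       = 0
  degree (c ∷ cs) =
    if does (all? (Fin._≟ 0#) cs) then 0 else suc (degree cs)

-- The sum of the values of f, taken in the integers and not modulo p. It is a
-- sum of nonnegative integers, so ℕ suffices.
valueSum : {p : ℕ} → (𝔽 p → 𝔽 p) → ℕ
valueSum f = sum +-0-commutativeMonoid (λ i → toℕ (f i))

IsConstant : {p : ℕ} → (𝔽 p → 𝔽 p) → Set
IsConstant f = ∃[ c ] ∀ x → f x ≡ c

{-# OPTIONS --safe #-}

-- Let f be the product of the x − i with multiplicities g̃(i), a monic polynomial
-- of degree p. Then (x − xᵖ) f′ = q f for the polynomial q = Σ g̃(i) δᵢ, where
-- δᵢ = (x − xᵖ) / (x − i) has degree p − 1 and is the indicator function of i.
-- So q and g have the same values, and q = g as both have degree less than p.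
-- Now suppose that 2 deg g + 2 < p and let s = −g, so that s f + (x − xᵖ) f′ = 0.
-- The coefficients of index at least p in this identity first show that those of
-- f vanish strictly between deg g + 1 and p, and then that f′ = s. Therefore
-- s (f + x − xᵖ) = 0, so either s = 0 or f = xᵖ − x and s = f′ = −1.

module Submission where

open import Defs using (Polynomial; ⟦_⟧; degree; valueSum; IsConstant)
open import Data.Nat using (ℕ; NonZero; _≤_; _∸_; _/_)
open import Data.Nat.Divisibility using (_∤_)
open import Data.Nat.Primality using (Prime)
open import Data.Sum using (_⊎_)
open import Relation.Binary.PropositionalEquality using (_≡_)

open import Algebra.Bundles using (CommutativeSemiring)
open import Algebra.Core using (Op₂)
open import Algebra.Structures using (IsCommutativeSemiring)
open import Data.Empty using (⊥-elim)
open import Data.Fin as Fin using (Fin; zero; suc; toℕ; fromℕ; inject₁)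
open import Data.Fin.Properties
  using (suc-injective; toℕ-injective; toℕ<n; toℕ-fromℕ; toℕ-fromℕ<; toℕ-inject₁)
open import Data.List using (List; []; _∷_; _++_; length; map; replicate; take)
open import Data.List.Properties using (length-++; length-map; length-replicate; length-take)
open import Data.List.Relation.Unary.All using (All; []; _∷_; all?)
open import Data.Nat as ℕ using (zero; suc; _<_; _%_; _!; z≤n; s≤s)
open import Data.Nat.Combinatorics using (_C_; nCn≡1; nCk≡n!/k![n-k]!; k![n∸k]!∣n!)
open import Data.Nat.DivMod
  using (_mod_; m%n<n; m<n⇒m%n≡m; n%n≡0; m*n%n≡0; %-distribˡ-+; %-distribˡ-*; m/n*n≡m; m/n*n≤m)
open import Data.Nat.Divisibility
  using (_∣_; divides; m∣m*n; >⇒∤; ∣1⇒≡1; m%n≡0⇒n∣m; n∣m⇒m%n≡0)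
open import Data.Nat.Primality using (euclidsLemma; ¬prime[0]; ¬prime[1])
import Data.Nat.Properties as ℕ
open import Algebra.Properties.CommutativeMonoid.Sum ℕ.+-0-commutativeMonoid using (sum)
open import Data.Product using (∃-syntax; _,_)
open import Data.Sum as Sum using (inj₁; inj₂; [_,_]′)
open import Function using (_∘_; id)
open import Relation.Binary using (DecidableEquality; tri<; tri≈; tri>)
open import Relation.Binary.PropositionalEquality
  using (_≢_; _≗_; refl; sym; trans; cong; cong₂; subst; isEquivalence; module ≡-Reasoning)
open import Relation.Nullary using (yes; no)

-- Polynomials over a commutative semiring acting on power series.

module Polynomials
  {F : Set} {plus times : Op₂ F} {zer one : F}
  (isCommutativeSemiring : IsCommutativeSemiring _≡_ plus times zer one)
  where

  private
    R : CommutativeSemiring _ _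
    R = record { isCommutativeSemiring = isCommutativeSemiring }

  open CommutativeSemiring R using (_+_; _*_; 0#; 1#; rawSemiring; +-rawMonoid)
  open import Algebra.Solver.Ring.NaturalCoefficients.Default R
    using (solve; _:+_; _:*_; _:=_; con)
  open import Algebra.Definitions.RawMonoid +-rawMonoid public using (_×_)
  open import Algebra.Definitions.RawSemiring rawSemiring public using (_^_)

  ι : ℕ → F
  ι n = n × 1#

  eval : List F → F → F
  eval []       x = 0#
  eval (c ∷ cs) x = c + x * eval cs x

  Series : Set
  Series = ℕ → F

  shift : Series → Series
  shift f zero    = 0#
  shift f (suc n) = f n

  shiftBy : ℕ → Series → Series
  shiftBy zero    f = f
  shiftBy (suc k) f = shift (shiftBy k f)

  -- `cs • 1ˢ` is the coefficient sequence of `cs`, continued by zeros; lists and series are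
  -- compared through it.
  1ˢ : Series
  1ˢ zero    = 1#
  1ˢ (suc _) = 0#

  -- Multiplication by the linear polynomial x + b.
  linear : F → Series → Series
  linear b f n = shift f n + b * f n

  derivative : Series → Series
  derivative f n = ι (suc n) * f (suc n)

  infixr 7 _•_

  -- A polynomial is a list of coefficients, as in Defs, and acts by multiplication on
  -- power series, so that no convolution sums occur.
  _•_ : List F → Series → Series
  ([]     • f) n = 0#
  ((c ∷ cs) • f) n = c * f n + shift (cs • f) n

  shift-cong : ∀ {f g} → f ≗ g → shift f ≗ shift g
  shift-cong eq zero    = refl
  shift-cong eq (suc n) = eq n

  shiftBy-cong : ∀ k {f g} → f ≗ g → shiftBy k f ≗ shiftBy k g
  shiftBy-cong zero    eq = eq
  shiftBy-cong (suc k) eq = shift-cong (shiftBy-cong k eq)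

  shiftBy-+ : ∀ k f m → shiftBy k f (k ℕ.+ m) ≡ f m
  shiftBy-+ zero    f m = refl
  shiftBy-+ (suc k) f m = shiftBy-+ k f m

  shiftBy-< : ∀ {k n} f → n < k → shiftBy k f n ≡ 0#
  shiftBy-< {suc k} {zero}  f n<k       = refl
  shiftBy-< {suc k} {suc n} f (s≤s n<k) = shiftBy-< f n<k

  linear-cong : ∀ b {f g} → f ≗ g → linear b f ≗ linear b g
  linear-cong b eq n = cong₂ (λ u v → u + b * v) (shift-cong eq n) (eq n)

  linear-+ : ∀ b f g → linear b (λ n → f n + g n) ≗ λ n → linear b f n + linear b g n
  linear-+ b f g zero    =
    solve 3 (λ b u v → con 0 :+ b :* (u :+ v) := (con 0 :+ b :* u) :+ (con 0 :+ b :* v)) refl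
      b (f 0) (g 0)
  linear-+ b f g (suc n) =
    solve 5 (λ b u v u' v' → (u' :+ v') :+ b :* (u :+ v) := (u' :+ b :* u) :+ (v' :+ b :* v)) refl
      b (f (suc n)) (g (suc n)) (f n) (g n)

  •-cong : ∀ cs {f g} → f ≗ g → cs • f ≗ cs • g
  •-cong []       eq n = refl
  •-cong (c ∷ cs) eq n = cong₂ (λ u v → c * u + v) (eq n) (shift-cong (•-cong cs eq) n)

  •-shift : ∀ cs f → cs • shift f ≗ shift (cs • f)
  •-shift []       f zero    = refl
  •-shift []       f (suc n) = refl
  •-shift (c ∷ cs) f zero    = solve 1 (λ c → c :* con 0 :+ con 0 := con 0) refl c
  •-shift (c ∷ cs) f (suc n) = cong (c * f n +_) (•-shift cs f n)

  •-shiftBy : ∀ cs k f → cs • shiftBy k f ≗ shiftBy k (cs • f)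
  •-shiftBy cs zero    f n = refl
  •-shiftBy cs (suc k) f n =
    trans (•-shift cs (shiftBy k f) n) (shift-cong (•-shiftBy cs k f) n)

  •-+* : ∀ cs f b g → cs • (λ n → f n + b * g n) ≗ λ n → (cs • f) n + b * (cs • g) n
  •-+* []       f b g n       = solve 1 (λ b → con 0 := con 0 :+ b :* con 0) refl b
  •-+* (c ∷ cs) f b g zero    =
    solve 4 (λ c b u v → c :* (u :+ b :* v) :+ con 0 :=
                         (c :* u :+ con 0) :+ b :* (c :* v :+ con 0)) refl
      c b (f 0) (g 0)
  •-+* (c ∷ cs) f b g (suc n) = trans
    (cong (c * (f (suc n) + b * g (suc n)) +_) (•-+* cs f b g n))
    (solve 6 (λ c b u v u' v' → c :* (u :+ b :* v) :+ (u' :+ b :* v') :=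
                                (c :* u :+ u') :+ b :* (c :* v :+ v')) refl
      c b (f (suc n)) (g (suc n)) ((cs • f) n) ((cs • g) n))

  -- No product of two lists is defined. This commutation takes the place of its associativity and
  -- commutativity in the induction on the roots of a product.
  •-linear : ∀ cs b f → cs • linear b f ≗ linear b (cs • f)
  •-linear cs b f n =
    trans (•-+* cs (shift f) b f n) (cong (_+ b * (cs • f) n) (•-shift cs f n))

  -- Coefficient `n` of the product involves only the `f k` in the window `n − length cs < k ≤ n`.
  -- Degree bounds on products are read off from this window.
  •-vanish : ∀ cs {f} n → (∀ k → k ≤ n → n < k ℕ.+ length cs → f k ≡ 0#) →
             (cs • f) n ≡ 0#
  •-vanish []           n f≡0 = refl
  •-vanish (c ∷ cs) {f} n f≡0 = trans
    (cong₂ (λ u v → c * u + v) (f≡0 n ℕ.≤-refl (ℕ.m<m+n n (s≤s z≤n))) (lemma n f≡0))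
    (solve 1 (λ c → c :* con 0 :+ con 0 := con 0) refl c)
    where
    lemma : ∀ n → (∀ k → k ≤ n → n < k ℕ.+ suc (length cs) → f k ≡ 0#) →
            shift (cs • f) n ≡ 0#
    lemma zero    f≡0 = refl
    lemma (suc n) f≡0 = •-vanish cs n λ k k≤n n<k+l →
      f≡0 k (ℕ.m≤n⇒m≤1+n k≤n) (subst (suc n <_) (sym (ℕ.+-suc k _)) (s≤s n<k+l))

  -- The Leibniz rule for the factor `x + b`, whose derivative is 1.
  derivative-linear : ∀ b f → derivative (linear b f) ≗ λ n → f n + linear b (derivative f) n
  derivative-linear b f zero =
    solve 3 (λ b u v → (con 1 :+ con 0) :* (u :+ b :* v) :=
                       u :+ (con 0 :+ b :* ((con 1 :+ con 0) :* v))) refl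
      b (f 0) (f 1)
  derivative-linear b f (suc n) =
    solve 4 (λ k b u v → (con 1 :+ k) :* (u :+ b :* v) :=
                         u :+ (k :* u :+ b :* ((con 1 :+ k) :* v))) refl
      (ι (suc n)) b (f (suc n)) (f (suc (suc n)))

  -- Sums of polynomials and division by a linear factor.

  infixl 6 _⊞_

  _⊞_ : List F → List F → List F
  []       ⊞ ds       = ds
  (c ∷ cs) ⊞ []       = c ∷ cs
  (c ∷ cs) ⊞ (d ∷ ds) = c + d ∷ cs ⊞ ds

  length-⊞ : ∀ {n} cs ds → length cs ≤ n → length ds ≤ n → length (cs ⊞ ds) ≤ n
  length-⊞ []       ds       p       q       = q
  length-⊞ (c ∷ cs) []       p       q       = p
  length-⊞ (c ∷ cs) (d ∷ ds) (s≤s p) (s≤s q) = s≤s (length-⊞ cs ds p q)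

  eval-⊞ : ∀ cs ds x → eval (cs ⊞ ds) x ≡ eval cs x + eval ds x
  eval-⊞ []       ds       x = solve 1 (λ u → u := con 0 :+ u) refl (eval ds x)
  eval-⊞ (c ∷ cs) []       x = solve 1 (λ u → u := u :+ con 0) refl (eval (c ∷ cs) x)
  eval-⊞ (c ∷ cs) (d ∷ ds) x = trans (cong (λ u → c + d + x * u) (eval-⊞ cs ds x))
    (solve 5 (λ c d x u v → c :+ d :+ x :* (u :+ v) := (c :+ x :* u) :+ (d :+ x :* v)) refl
      c d x (eval cs x) (eval ds x))

  ⊞-• : ∀ cs ds f → (cs ⊞ ds) • f ≗ λ n → (cs • f) n + (ds • f) n
  ⊞-• []       ds       f n       = solve 1 (λ u → u := con 0 :+ u) refl ((ds • f) n)
  ⊞-• (c ∷ cs) []       f n       = solve 1 (λ u → u := u :+ con 0) refl (((c ∷ cs) • f) n)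
  ⊞-• (c ∷ cs) (d ∷ ds) f zero    =
    solve 3 (λ c d u → (c :+ d) :* u :+ con 0 := (c :* u :+ con 0) :+ (d :* u :+ con 0)) refl
      c d (f 0)
  ⊞-• (c ∷ cs) (d ∷ ds) f (suc n) = trans
    (cong ((c + d) * f (suc n) +_) (⊞-• cs ds f n))
    (solve 5 (λ c d u v w → (c :+ d) :* u :+ (v :+ w) := (c :* u :+ v) :+ (d :* u :+ w)) refl
      c d (f (suc n)) ((cs • f) n) ((ds • f) n))

  eval-zero : ∀ {cs} → All (_≡ 0#) cs → ∀ x → eval cs x ≡ 0#
  eval-zero []              x = refl
  eval-zero (c≡0 ∷ cs≡0) x = trans (cong₂ (λ u v → u + x * v) c≡0 (eval-zero cs≡0 x))
    (solve 1 (λ x → con 0 :+ x :* con 0 := con 0) refl x)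

  •-zero : ∀ {cs} → All (_≡ 0#) cs → ∀ f n → (cs • f) n ≡ 0#
  •-zero []                 f n = refl
  •-zero (_∷_ {xs = cs} c≡0 cs≡0) f n = trans
    (cong₂ (λ u v → u * f n + v) c≡0 (lemma n))
    (solve 1 (λ u → con 0 :* u :+ con 0 := con 0) refl (f n))
    where
    lemma : ∀ n → shift (cs • f) n ≡ 0#
    lemma zero    = refl
    lemma (suc n) = •-zero cs≡0 f n

  -- If p is the polynomial c ∷ cs, then quotient a cs is (p(x) − p(a)) / (x − a).
  quotient : F → List F → List F
  quotient a []       = []
  quotient a (c ∷ cs) = eval (c ∷ cs) a ∷ quotient a cs

  length-quotient : ∀ a cs → length (quotient a cs) ≡ length cs
  length-quotient a []       = refl
  length-quotient a (c ∷ cs) = cong suc (length-quotient a cs)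

  module _ {a b : F} (a+b≡0 : a + b ≡ 0#) where

    -- Horner's scheme: division by `x − a`, the remainder being the value at `a`. As a semiring has
    -- no subtraction, `b` stands for `−a`.
    eval-quotient : ∀ c cs x →
      eval (c ∷ cs) x ≡ eval (c ∷ cs) a + (x + b) * eval (quotient a cs) x
    eval-quotient c []       x =
      solve 4 (λ a b c x → c :+ x :* con 0 := (c :+ a :* con 0) :+ (x :+ b) :* con 0) refl
        a b c x
    eval-quotient c (d ∷ ds) x = begin
      c + x * eval (d ∷ ds) x
        ≡⟨ cong (λ u → c + x * u) (eval-quotient d ds x) ⟩
      c + x * (e + (x + b) * q)
        -- A zero multiple of `e` is inserted in order to be replaced by `(a + b) * e`; what remains
        -- is then an identity of semirings.
        ≡⟨ solve 3 (λ e u v → u :+ v := u :+ con 0 :* e :+ v) refl e c (x * (e + (x + b) * q)) ⟩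
      c + 0# * e + x * (e + (x + b) * q)
        ≡⟨ cong (λ u → c + u * e + x * (e + (x + b) * q)) (sym a+b≡0) ⟩
      c + (a + b) * e + x * (e + (x + b) * q)
        ≡⟨ solve 6 (λ a b c x e q → c :+ (a :+ b) :* e :+ x :* (e :+ (x :+ b) :* q) :=
                      c :+ a :* e :+ (x :+ b) :* (e :+ x :* q)) refl a b c x e q ⟩
      c + a * e + (x + b) * (e + x * q) ∎
      where
      open ≡-Reasoning
      e = eval (d ∷ ds) a
      q = eval (quotient a ds) x

    -- The same division as an identity between coefficients. It does not follow from the one for
    -- values, because over a finite field a polynomial is not determined by its values.
    •-quotient : ∀ c cs f →
      (c ∷ cs) • f ≗ λ n → eval (c ∷ cs) a * f n + linear b (quotient a cs • f) n
    •-quotient c []       f zero    =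
      solve 4 (λ a b c u → c :* u :+ con 0 := (c :+ a :* con 0) :* u :+ (con 0 :+ b :* con 0)) refl
        a b c (f 0)
    •-quotient c []       f (suc n) =
      solve 4 (λ a b c u → c :* u :+ con 0 := (c :+ a :* con 0) :* u :+ (con 0 :+ b :* con 0)) refl
        a b c (f (suc n))
    •-quotient c (d ∷ ds) f zero    = begin
      c * u + 0#
        ≡⟨ solve 3 (λ c u e → c :* u :+ con 0 := c :* u :+ con 0 :* (e :* u)) refl c u e ⟩
      c * u + 0# * (e * u)
        ≡⟨ cong (λ v → c * u + v * (e * u)) (sym a+b≡0) ⟩
      c * u + (a + b) * (e * u)
        ≡⟨ solve 5 (λ a b c u e → c :* u :+ (a :+ b) :* (e :* u) :=
                      (c :+ a :* e) :* u :+ (con 0 :+ b :* (e :* u :+ con 0))) refl a b c u e ⟩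
      (c + a * e) * u + (0# + b * (e * u + 0#)) ∎
      where
      open ≡-Reasoning
      e = eval (d ∷ ds) a
      u = f 0
    •-quotient c (d ∷ ds) f (suc n) = begin
      c * u + ((d ∷ ds) • f) n
        ≡⟨ cong (c * u +_) (•-quotient d ds f n) ⟩
      c * u + (e * f n + (s + b * q))
        ≡⟨ solve 7 (λ b c u e v s q → c :* u :+ (e :* v :+ (s :+ b :* q)) :=
                      c :* u :+ con 0 :* (e :* u) :+ (e :* v :+ (s :+ b :* q))) refl
             b c u e (f n) s q ⟩
      c * u + 0# * (e * u) + (e * f n + (s + b * q))
        ≡⟨ cong (λ v → c * u + v * (e * u) + (e * f n + (s + b * q))) (sym a+b≡0) ⟩
      c * u + (a + b) * (e * u) + (e * f n + (s + b * q))
        ≡⟨ solve 8 (λ a b c u e v s q →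
                      c :* u :+ (a :+ b) :* (e :* u) :+ (e :* v :+ (s :+ b :* q)) :=
                      (c :+ a :* e) :* u :+ ((e :* v :+ s) :+ b :* (e :* u :+ q))) refl
             a b c u e (f n) s q ⟩
      (c + a * e) * u + ((e * f n + s) + b * (e * u + q)) ∎
      where
      open ≡-Reasoning
      e = eval (d ∷ ds) a
      u = f (suc n)
      q = (quotient a ds • f) n
      s = shift (quotient a ds • f) n

  -- The coefficients of the quotient depend on those of `cs` through a unitriangular system, which
  -- is solved starting from the leading coefficient.
  quotient-zero : ∀ a cs → All (_≡ 0#) (quotient a cs) → All (_≡ 0#) cs
  quotient-zero a []       []           = []
  quotient-zero a (c ∷ cs) (e≡0 ∷ q≡0) = c≡0 ∷ cs≡0
    where
    cs≡0 = quotient-zero a cs q≡0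
    c≡0 : c ≡ 0#
    c≡0 = trans (solve 2 (λ c a → c := c :+ a :* con 0) refl c a)
                (trans (cong (λ u → c + a * u) (sym (eval-zero cs≡0 a))) e≡0)

  1ˢ-zero : ∀ cs → (∀ n → (cs • 1ˢ) n ≡ 0#) → All (_≡ 0#) cs
  1ˢ-zero []       eq = []
  1ˢ-zero (c ∷ cs) eq =
    trans (solve 1 (λ c → c := c :* con 1 :+ con 0) refl c) (eq 0) ∷
    1ˢ-zero cs λ n → trans (solve 2 (λ c u → u := c :* con 0 :+ u) refl c ((cs • 1ˢ) n)) (eq (suc n))

  eval-constant : ∀ cs → (∀ n → (cs • 1ˢ) (suc n) ≡ 0#) → ∃[ c ] ∀ x → eval cs x ≡ c
  eval-constant []       eq = 0# , λ _ → refl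
  eval-constant (c ∷ cs) eq = c , λ x → trans
    (cong (λ u → c + x * u) (eval-zero cs≡0 x))
    (solve 2 (λ c x → c :+ x :* con 0 := c) refl c x)
    where
    cs≡0 : All (_≡ 0#) cs
    cs≡0 = 1ˢ-zero cs λ n →
      trans (solve 2 (λ c u → u := c :* con 0 :+ u) refl c ((cs • 1ˢ) n)) (eq n)

  -- Of the `f k` that enter coefficient `suc q + m`, those with `k < suc q` lie in the gap below
  -- the leading term and those with `k > suc q` lie above the degree. Only the leading 1 is left,
  -- and it meets coefficient `m` of `cs`.
  •-monic : ∀ {q f} → f (suc q) ≡ 1# → (∀ k → suc q < k → f k ≡ 0#) →
    ∀ cs → (∀ k → k < suc q → suc q < k ℕ.+ length cs → f k ≡ 0#) →
    ∀ m → (cs • f) (suc q ℕ.+ m) ≡ (cs • 1ˢ) m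
  •-monic             lead above []       gap m       = refl
  •-monic {q} {f} lead above (c ∷ cs) gap zero    =
    cong₂ (λ u v → c * u + v)
      (trans (cong f (ℕ.+-identityʳ (suc q))) lead)
      (trans (cong (cs • f) (ℕ.+-identityʳ q))
        (•-vanish cs q λ k k≤q q<k+l →
          gap k (s≤s k≤q) (subst (suc q <_) (sym (ℕ.+-suc k _)) (s≤s q<k+l))))
  •-monic {q} {f} lead above (c ∷ cs) gap (suc m) =
    cong₂ (λ u v → c * u + v)
      (above (suc q ℕ.+ suc m) (ℕ.m<m+n (suc q) (s≤s z≤n)))
      (trans (cong (cs • f) (ℕ.+-suc q m))
        (•-monic lead above cs (λ k k<p p<k+l → gap k k<p
          (ℕ.<-≤-trans p<k+l (ℕ.+-monoʳ-≤ k (ℕ.n≤1+n _)))) m))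

  •-+ : ∀ cs f g → cs • (λ n → f n + g n) ≗ λ n → (cs • f) n + (cs • g) n
  •-+ cs f g n = begin
    (cs • (λ k → f k + g k)) n
      ≡⟨ •-cong cs (λ k → solve 2 (λ u v → u :+ v := u :+ con 1 :* v) refl (f k) (g k)) n ⟩
    (cs • (λ k → f k + 1# * g k)) n
      ≡⟨ •-+* cs f 1# g n ⟩
    (cs • f) n + 1# * (cs • g) n
      ≡⟨ solve 2 (λ u v → u :+ con 1 :* v := u :+ v) refl ((cs • f) n) ((cs • g) n) ⟩
    (cs • f) n + (cs • g) n ∎
    where open ≡-Reasoning

  shift-* : ∀ b f → shift (λ k → b * f k) ≗ λ n → b * shift f n
  shift-* b f zero    = solve 1 (λ b → con 0 := b :* con 0) refl b
  shift-* b f (suc n) = refl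

  +-identityˡ′ : ∀ {x y} → x ≡ 0# → x + y ≡ y
  +-identityˡ′ {y = y} refl = solve 1 (λ y → con 0 :+ y := y) refl y

  -- Roots and zero divisors over an integral domain.

  -- Negation is written as multiplication by -1#: most identities are then semiring
  -- identities, which the solver with natural coefficients proves.
  module IntegralDomain
    (-1# : F) (1+-1≡0 : 1# + -1# ≡ 0#)
    (_≟_ : DecidableEquality F)
    (integral : ∀ x y → x * y ≡ 0# → x ≡ 0# ⊎ y ≡ 0#)
    where

    +-inverse : ∀ x → x + -1# * x ≡ 0#
    +-inverse x = begin
      x + -1# * x    ≡⟨ solve 2 (λ ν x → x :+ ν :* x := (con 1 :+ ν) :* x) refl -1# x ⟩
      (1# + -1#) * x ≡⟨ cong (_* x) 1+-1≡0 ⟩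
      0# * x         ≡⟨ solve 1 (λ x → con 0 :* x := con 0) refl x ⟩
      0#             ∎
      where open ≡-Reasoning

    difference-zero : ∀ x y → x + -1# * y ≡ 0# → x ≡ y
    difference-zero x y eq = begin
      x                    ≡⟨ solve 1 (λ x → x := con 0 :+ x) refl x ⟩
      0# + x               ≡⟨ cong (_+ x) (sym (+-inverse y)) ⟩
      y + -1# * y + x      ≡⟨ solve 3 (λ x y z → y :+ z :+ x := x :+ z :+ y) refl x y (-1# * y) ⟩
      x + -1# * y + y      ≡⟨ +-identityˡ′ eq ⟩
      y                    ∎
      where open ≡-Reasoning

    -- Division by `x − e zero` leaves a quotient that vanishes at the other points: they differ
    -- from `e zero`, and there are no zero divisors. By induction the quotient is zero, hence so is
    -- `cs`.
    roots-zero : ∀ {n} cs (e : Fin n → F) → (∀ {i j} → e i ≡ e j → i ≡ j) →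
                 (∀ i → eval cs (e i) ≡ 0#) → length cs ≤ n → All (_≡ 0#) cs
    roots-zero []       e inj root l≤n       = []
    roots-zero {suc n} (c ∷ cs) e inj root (s≤s l≤n) = c≡0 ∷ cs≡0
      where
      a = e zero
      quotient-root : ∀ i → eval (quotient a cs) (e (suc i)) ≡ 0#
      quotient-root i
        with integral _ _ (trans (sym (+-identityˡ′ (root zero)))
               (trans (sym (eval-quotient (+-inverse a) c cs (e (suc i)))) (root (suc i))))
      ... | inj₂ q≡0 = q≡0
      ... | inj₁ d≡0 with inj (difference-zero _ _ d≡0)
      ...   | ()
      cs≡0 : All (_≡ 0#) cs
      cs≡0 = quotient-zero a cs (roots-zero (quotient a cs) (e ∘ suc) (suc-injective ∘ inj)
        quotient-root (subst (_≤ n) (sym (length-quotient a cs)) l≤n))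
      c≡0 : c ≡ 0#
      c≡0 = trans (solve 2 (λ c a → c := c :+ a :* con 0) refl c a)
                  (trans (cong (λ u → c + a * u) (sym (eval-zero cs≡0 a))) (root zero))

    -- Zeros at the low end of `cs` are stripped until a nonzero `c` is reached. Then coefficient
    -- `k` of the product is `c * f k` plus terms in earlier `f j`, so that all `f k` vanish by
    -- strong induction.
    •-integral : ∀ cs f → (∀ n → (cs • f) n ≡ 0#) → All (_≡ 0#) cs ⊎ (∀ n → f n ≡ 0#)
    •-integral []       f eq = inj₁ []
    •-integral (c ∷ cs) f eq with c ≟ 0#
    ... | yes c≡0 = [ inj₁ ∘ (c≡0 ∷_) , inj₂ ]′ (•-integral cs f tail≡0)
      where
      tail≡0 : ∀ n → (cs • f) n ≡ 0#
      tail≡0 n = trans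
        (sym (+-identityˡ′ (trans (cong (_* f (suc n)) c≡0)
                                  (solve 1 (λ u → con 0 :* u := con 0) refl (f (suc n))))))
        (eq (suc n))
    ... | no c≢0 = inj₂ λ n → below (suc n) n ℕ.≤-refl
      where
      below : ∀ n k → k < n → f k ≡ 0#
      below (suc n) k (s≤s k≤n) =
        [ ⊥-elim ∘ c≢0 , id ]′ (integral c (f k) (trans
          (solve 1 (λ u → u := u :+ con 0) refl (c * f k))
          (trans (cong (c * f k +_) (sym (rest k k≤n))) (eq k))))
        where
        rest : ∀ k → k ≤ n → shift (cs • f) k ≡ 0#
        rest zero    k≤n = refl
        rest (suc k) k<n = •-vanish cs k λ j j≤k _ → below n j (ℕ.≤-<-trans j≤k k<n)

    monicProduct : List F → Series
    monicProduct []       = 1ˢ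
    monicProduct (a ∷ as) = linear (-1# * a) (monicProduct as)

    monicProduct-> : ∀ as {n} → length as < n → monicProduct as n ≡ 0#
    monicProduct-> []       {suc n} l<n       = refl
    monicProduct-> (a ∷ as) {suc n} (s≤s l<n) = trans
      (cong₂ (λ u v → u + (-1# * a) * v)
        (monicProduct-> as l<n) (monicProduct-> as (ℕ.m≤n⇒m≤1+n l<n)))
      (solve 1 (λ b → con 0 :+ b :* con 0 := con 0) refl (-1# * a))

    monicProduct-lead : ∀ as → monicProduct as (length as) ≡ 1#
    monicProduct-lead []       = refl
    monicProduct-lead (a ∷ as) = trans
      (cong₂ (λ u v → u + (-1# * a) * v)
        (monicProduct-lead as) (monicProduct-> as ℕ.≤-refl))
      (solve 1 (λ b → con 1 :+ b :* con 0 := con 1) refl (-1# * a))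

    negMonomial : ℕ → List F
    negMonomial zero    = -1# ∷ []
    negMonomial (suc k) = 0# ∷ negMonomial k

    length-negMonomial : ∀ k → length (negMonomial k) ≡ suc k
    length-negMonomial zero    = refl
    length-negMonomial (suc k) = cong suc (length-negMonomial k)

    eval-negMonomial : ∀ k x → eval (negMonomial k) x ≡ -1# * x ^ k
    eval-negMonomial zero    x = solve 2 (λ ν x → ν :+ x :* con 0 := ν :* con 1) refl -1# x
    eval-negMonomial (suc k) x = trans (cong (λ u → 0# + x * u) (eval-negMonomial k x))
      (solve 3 (λ ν x y → con 0 :+ x :* (ν :* y) := ν :* (x :* y)) refl -1# x (x ^ k))

    negMonomial-• : ∀ k f → negMonomial k • f ≗ λ n → -1# * shiftBy k f n
    negMonomial-• zero    f zero    = solve 1 (λ u → u :+ con 0 := u) refl (-1# * f 0)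
    negMonomial-• zero    f (suc n) = solve 1 (λ u → u :+ con 0 := u) refl (-1# * f (suc n))
    negMonomial-• (suc k) f zero    =
      solve 2 (λ ν u → con 0 :* u :+ con 0 := ν :* con 0) refl -1# (f 0)
    negMonomial-• (suc k) f (suc n) = trans
      (cong (0# * f (suc n) +_) (negMonomial-• k f n))
      (solve 2 (λ u v → con 0 :* u :+ v := v) refl (f (suc n)) (-1# * shiftBy k f n))

    -- The list is the difference quotient of `−x^(k+1)` at `a`, so its value at `a` is the
    -- derivative there.
    eval-quotient-negMonomial : ∀ k a →
      eval (quotient a (negMonomial k)) a ≡ -1# * (ι (suc k) * a ^ k)
    eval-quotient-negMonomial zero    a =
      solve 2 (λ ν a → (ν :+ a :* con 0) :+ a :* con 0 := ν :* ((con 1 :+ con 0) :* con 1)) refl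
        -1# a
    eval-quotient-negMonomial (suc k) a = trans
      (cong₂ (λ u v → 0# + a * u + a * v) (eval-negMonomial k a) (eval-quotient-negMonomial k a))
      (solve 4 (λ ν a y i → con 0 :+ a :* (ν :* y) :+ a :* (ν :* (i :* y)) :=
                            ν :* ((con 1 :+ i) :* (a :* y))) refl
        -1# a (a ^ k) (ι (suc k)))

    -- Indicator polynomials and logarithmic derivatives in characteristic `p`.

    module PrimeOrder
      (m : ℕ)
      (ιp≡0 : ι (suc (suc m)) ≡ 0#)
      (ι≢0 : ∀ {k} → 0 < k → k < suc (suc m) → ι k ≢ 0#)
      (fermat : ∀ x → x ^ suc (suc m) ≡ x)
      where

      private
        p : ℕ
        p = suc (suc m)

      -- With `p = m + 2`, the two entries in front move `−x^m` to `−x^p`.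
      x-xᵖ : List F
      x-xᵖ = 0# ∷ 1# ∷ negMonomial m

      eval-x-xᵖ : ∀ a → eval x-xᵖ a ≡ 0#
      eval-x-xᵖ a = begin
        0# + a * (1# + a * eval (negMonomial m) a)
          ≡⟨ cong (λ u → 0# + a * (1# + a * u)) (eval-negMonomial m a) ⟩
        0# + a * (1# + a * (-1# * a ^ m))
          ≡⟨ solve 3 (λ ν a y → con 0 :+ a :* (con 1 :+ a :* (ν :* y)) :=
                                a :+ ν :* (a :* (a :* y))) refl -1# a (a ^ m) ⟩
        a + -1# * a ^ p
          ≡⟨ cong (λ u → a + -1# * u) (fermat a) ⟩
        a + -1# * a
          ≡⟨ +-inverse a ⟩
        0# ∎
        where open ≡-Reasoning

      x-xᵖ-• : ∀ f → x-xᵖ • f ≗ λ n → shift f n + -1# * shiftBy p f n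
      x-xᵖ-• f zero    = solve 2 (λ ν u → con 0 :* u :+ con 0 := con 0 :+ ν :* con 0) refl -1# (f 0)
      x-xᵖ-• f (suc n) = trans
        (cong (λ u → 0# * f (suc n) + (1# * f n + u))
          (trans (shift-cong (negMonomial-• m f) n) (shift-* -1# (shiftBy m f) n)))
        (solve 3 (λ u v w → con 0 :* u :+ (con 1 :* v :+ w) := v :+ w) refl
          (f (suc n)) (f n) (-1# * shift (shiftBy m f) n))

      -- The polynomial (x − xᵖ) / (x − a), which is the indicator function of a.
      δ : F → List F
      δ a = quotient a (1# ∷ negMonomial m)

      length-δ : ∀ a → length (δ a) ≡ p
      length-δ a = trans (length-quotient a (1# ∷ negMonomial m)) (cong suc (length-negMonomial m))

      -- The remainder of the division is the value of `x − xᵖ` at `a`, which is zero by Fermat's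
      -- little theorem.
      linear-δ : ∀ a f → linear (-1# * a) (δ a • f) ≗ x-xᵖ • f
      linear-δ a f n = sym (trans (•-quotient (+-inverse a) 0# (1# ∷ negMonomial m) f n)
        (+-identityˡ′ (trans (cong (_* f n) (eval-x-xᵖ a))
                             (solve 1 (λ u → con 0 :* u := con 0) refl (f n)))))

      -- The product of `x − a` and the value of `δ a` at `x` is `x − xᵖ`, hence zero, and the first
      -- factor is not.
      eval-δ-≢ : ∀ {a x} → x ≢ a → eval (δ a) x ≡ 0#
      eval-δ-≢ {a} {x} x≢a =
        [ ⊥-elim ∘ x≢a ∘ difference-zero x a , id ]′ (integral _ _ (trans
          (sym (+-identityˡ′ (eval-x-xᵖ a)))
          (trans (sym (eval-quotient (+-inverse a) 0# (1# ∷ negMonomial m) x)) (eval-x-xᵖ x))))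

      -- This value is the derivative of `x − xᵖ` at `a`, namely `1 − p a^(p−1)`, and `p` is zero in
      -- `F`.
      eval-δ : ∀ a → eval (δ a) a ≡ 1#
      eval-δ a = begin
        1# + a * eval (negMonomial m) a + a * eval (quotient a (negMonomial m)) a
          ≡⟨ cong₂ (λ u v → 1# + a * u + a * v)
               (eval-negMonomial m a) (eval-quotient-negMonomial m a) ⟩
        1# + a * (-1# * a ^ m) + a * (-1# * (ι (suc m) * a ^ m))
          ≡⟨ solve 4 (λ ν a y i → con 1 :+ a :* (ν :* y) :+ a :* (ν :* (i :* y)) :=
                                  con 1 :+ (con 1 :+ i) :* (ν :* a :* y)) refl
               -1# a (a ^ m) (ι (suc m)) ⟩
        1# + ι p * (-1# * a * a ^ m)
          ≡⟨ cong (λ u → 1# + u * (-1# * a * a ^ m)) ιp≡0 ⟩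
        1# + 0# * (-1# * a * a ^ m)
          ≡⟨ solve 1 (λ u → con 1 :+ con 0 :* u := con 1) refl (-1# * a * a ^ m) ⟩
        1# ∎
        where open ≡-Reasoning

      -- s plus (x − xᵖ) times the logarithmic derivative of the product of the x − a.
      _⊞δ_ : List F → List F → List F
      s ⊞δ []       = s
      s ⊞δ (a ∷ as) = δ a ⊞ s ⊞δ as

      length-⊞δ : ∀ s as → length s ≤ p → length (s ⊞δ as) ≤ p
      length-⊞δ s []       l≤p = l≤p
      length-⊞δ s (a ∷ as) l≤p =
        length-⊞ (δ a) (s ⊞δ as) (ℕ.≤-reflexive (length-δ a)) (length-⊞δ s as l≤p)

      -- Multiplication by `f` clears the denominator of `f′ / f`. In the inductive step
      -- `g = (x − a) f`, and `δ a` times `g` is `(x − xᵖ) f`: this is the summand that the Leibniz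
      -- rule adds to `(x − xᵖ) (x − a) f′` in `(x − xᵖ) g′`.
      ⊞δ-• : ∀ s as → (s ⊞δ as) • monicProduct as ≗
             λ n → (s • monicProduct as) n + (x-xᵖ • derivative (monicProduct as)) n
      ⊞δ-• s []       n = trans
        (solve 1 (λ u → u := u :+ con 0) refl ((s • 1ˢ) n))
        (cong ((s • 1ˢ) n +_) (sym (•-vanish x-xᵖ n λ k _ _ →
          solve 1 (λ i → i :* con 0 := con 0) refl (ι (suc k)))))
      ⊞δ-• s (a ∷ as) n = begin
        ((δ a ⊞ s ⊞δ as) • g) n
          ≡⟨ ⊞-• (δ a) (s ⊞δ as) g n ⟩
        (δ a • g) n + ((s ⊞δ as) • g) n
          ≡⟨ cong₂ _+_
               (trans (•-linear (δ a) b f n) (linear-δ a f n))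
               (trans (•-linear (s ⊞δ as) b f n)
                 (trans (linear-cong b (⊞δ-• s as) n) (linear-+ b (s • f) (x-xᵖ • derivative f) n))) ⟩
        (x-xᵖ • f) n + (linear b (s • f) n + linear b (x-xᵖ • derivative f) n)
          ≡⟨ solve 3 (λ u v w → u :+ (v :+ w) := v :+ (u :+ w)) refl
               ((x-xᵖ • f) n) (linear b (s • f) n) (linear b (x-xᵖ • derivative f) n) ⟩
        linear b (s • f) n + ((x-xᵖ • f) n + linear b (x-xᵖ • derivative f) n)
          ≡⟨ cong₂ (λ u v → u + ((x-xᵖ • f) n + v))
               (sym (•-linear s b f n)) (sym (•-linear x-xᵖ b (derivative f) n)) ⟩
        (s • g) n + ((x-xᵖ • f) n + (x-xᵖ • linear b (derivative f)) n)
          ≡⟨ cong ((s • g) n +_) (sym (•-+ x-xᵖ f (linear b (derivative f)) n)) ⟩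
        (s • g) n + (x-xᵖ • (λ k → f k + linear b (derivative f) k)) n
          ≡⟨ cong ((s • g) n +_) (sym (•-cong x-xᵖ (derivative-linear b f) n)) ⟩
        (s • g) n + (x-xᵖ • derivative g) n ∎
        where
        open ≡-Reasoning
        b = -1# * a
        f = monicProduct as
        g = monicProduct (a ∷ as)

      eval-⊞δ-replicate : ∀ s k a as x →
        eval (s ⊞δ (replicate k a ++ as)) x ≡ ι k * eval (δ a) x + eval (s ⊞δ as) x
      eval-⊞δ-replicate s zero    a as x =
        solve 2 (λ u v → v := con 0 :* u :+ v) refl (eval (δ a) x) (eval (s ⊞δ as) x)
      eval-⊞δ-replicate s (suc k) a as x = begin
        eval (δ a ⊞ s ⊞δ (replicate k a ++ as)) x
          ≡⟨ eval-⊞ (δ a) (s ⊞δ (replicate k a ++ as)) x ⟩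
        eval (δ a) x + eval (s ⊞δ (replicate k a ++ as)) x
          ≡⟨ cong (eval (δ a) x +_) (eval-⊞δ-replicate s k a as x) ⟩
        eval (δ a) x + (ι k * eval (δ a) x + eval (s ⊞δ as) x)
          ≡⟨ solve 3 (λ i u v → u :+ (i :* u :+ v) := (con 1 :+ i) :* u :+ v) refl
               (ι k) (eval (δ a) x) (eval (s ⊞δ as) x) ⟩
        ι (suc k) * eval (δ a) x + eval (s ⊞δ as) x ∎
        where open ≡-Reasoning

      multiset : ∀ {n} → (Fin n → ℕ) → (Fin n → F) → List F
      multiset {zero}  w e = []
      multiset {suc n} w e = replicate (w zero) (e zero) ++ multiset (w ∘ suc) (e ∘ suc)

      length-multiset : ∀ {n} w (e : Fin n → F) → length (multiset w e) ≡ sum w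
      length-multiset {zero}  w e = refl
      length-multiset {suc n} w e = trans (length-++ (replicate (w zero) (e zero)))
        (cong₂ ℕ._+_ (length-replicate (w zero)) (length-multiset (w ∘ suc) (e ∘ suc)))

      eval-⊞δ-multiset-∉ : ∀ {n} s w (e : Fin n → F) x → (∀ i → x ≢ e i) →
                           eval (s ⊞δ multiset w e) x ≡ eval s x
      eval-⊞δ-multiset-∉ {zero}  s w e x x∉e = refl
      eval-⊞δ-multiset-∉ {suc n} s w e x x∉e = trans
        (eval-⊞δ-replicate s (w zero) (e zero) (multiset (w ∘ suc) (e ∘ suc)) x)
        (trans
          (cong₂ (λ u v → ι (w zero) * u + v)
            (eval-δ-≢ (x∉e zero)) (eval-⊞δ-multiset-∉ s (w ∘ suc) (e ∘ suc) x (x∉e ∘ suc)))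
          (solve 2 (λ i u → i :* con 0 :+ u := u) refl (ι (w zero)) (eval s x)))

      -- Lagrange interpolation of the multiplicities: at `e i` every `δ` vanishes except the `w i`
      -- copies that belong to `e i` itself, whose value is 1.
      eval-⊞δ-multiset : ∀ {n} s w (e : Fin n → F) → (∀ {i j} → e i ≡ e j → i ≡ j) → ∀ i →
                         eval (s ⊞δ multiset w e) (e i) ≡ ι (w i) + eval s (e i)
      eval-⊞δ-multiset s w e inj zero = trans
        (eval-⊞δ-replicate s (w zero) (e zero) (multiset (w ∘ suc) (e ∘ suc)) (e zero))
        (trans
          (cong₂ (λ u v → ι (w zero) * u + v)
            (eval-δ (e zero))
            (eval-⊞δ-multiset-∉ s (w ∘ suc) (e ∘ suc) (e zero) (λ j eq → 0≢suc (inj eq))))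
          (solve 2 (λ i u → i :* con 1 :+ u := i :+ u) refl (ι (w zero)) (eval s (e zero))))
        where
        0≢suc : ∀ {n} {j : Fin n} → zero ≢ Fin.suc j
        0≢suc ()
      eval-⊞δ-multiset s w e inj (suc i) = trans
        (eval-⊞δ-replicate s (w zero) (e zero) (multiset (w ∘ suc) (e ∘ suc)) (e (suc i)))
        (trans
          (cong₂ (λ u v → ι (w zero) * u + v)
            (eval-δ-≢ (λ eq → suc≢0 (inj eq)))
            (eval-⊞δ-multiset s (w ∘ suc) (e ∘ suc) (suc-injective ∘ inj) i))
          (solve 2 (λ i u → i :* con 0 :+ u := u) refl (ι (w zero)) (ι (w (suc i)) + eval s (e (suc i)))))
        where
        suc≢0 : ∀ {n} {j : Fin n} → Fin.suc j ≢ zero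
        suc≢0 ()

      -- The differential equation `s f + (x − xᵖ) f′ = 0` with `s` of small degree.

      module _
        (s as : List F) (2l<p : length s ℕ.+ length s < p) (length-as : length as ≡ p)
        (annihilates : ∀ n → (s • monicProduct as) n + (x-xᵖ • derivative (monicProduct as)) n ≡ 0#)
        where

        private
          f : Series
          f = monicProduct as

          lead : f p ≡ 1#
          lead = trans (cong f (sym length-as)) (monicProduct-lead as)

          above : ∀ k → p < k → f k ≡ 0#
          above k p<k = monicProduct-> as (subst (_< k) (sym length-as) p<k)

          -- The leading term `xᵖ` has derivative zero, so `f′` has degree below `p − 1`.
          above′ : ∀ n → derivative f (suc m ℕ.+ n) ≡ 0#
          above′ zero    = trans
            (cong₂ (λ u v → ι u * v) (ℕ.+-identityʳ p) refl)
            (trans (cong (_* f (p ℕ.+ 0)) ιp≡0)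
              (solve 1 (λ u → con 0 :* u := con 0) refl (f (p ℕ.+ 0))))
          above′ (suc n) = trans
            (cong (ι (p ℕ.+ suc n) *_) (above (p ℕ.+ suc n) (ℕ.m<m+n p (s≤s z≤n))))
            (solve 1 (λ i → i :* con 0 := con 0) refl (ι (p ℕ.+ suc n)))

          annihilates′ : ∀ n → (s • f) n + (shift (derivative f) n + -1# * shiftBy p (derivative f) n) ≡ 0#
          annihilates′ n = trans (cong ((s • f) n +_) (sym (x-xᵖ-• (derivative f) n))) (annihilates n)

          -- At index `p + n` the term `x f′` contributes nothing by `above′`, and `xᵖ f′`
          -- contributes coefficient `n` of `f′`.
          high : ∀ n → (s • f) (p ℕ.+ n) ≡ derivative f n
          high n = difference-zero _ _ (begin
            (s • f) (p ℕ.+ n) + -1# * derivative f n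
              ≡⟨ cong ((s • f) (p ℕ.+ n) +_) (sym (+-identityˡ′ (above′ n))) ⟩
            (s • f) (p ℕ.+ n) + (derivative f (suc m ℕ.+ n) + -1# * derivative f n)
              ≡⟨ cong (λ u → (s • f) (p ℕ.+ n) + (derivative f (suc m ℕ.+ n) + -1# * u))
                   (sym (shiftBy-+ p (derivative f) n)) ⟩
            (s • f) (p ℕ.+ n) + (derivative f (suc m ℕ.+ n) + -1# * shiftBy p (derivative f) (p ℕ.+ n))
              ≡⟨ annihilates′ (p ℕ.+ n) ⟩
            0# ∎)
            where open ≡-Reasoning

          -- Up to the invertible factor `k`, `f k` is coefficient `k − 1` of `f′`, and by `high`
          -- coefficient `p + k − 1` of `s f`. This index exceeds the degree of `s f` as soon as
          -- `length s ≤ k − 1`.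
          gap : ∀ k → k < p → p < k ℕ.+ length s → f k ≡ 0#
          -- From `2 * length s < p < k + length s` follows `length s < k`; in particular `k` is a
          -- successor.
          gap k k<p p<k+l with ℕ.+-cancelʳ-< (length s) (length s) k (ℕ.<-trans 2l<p p<k+l)
          gap (suc k) k<p p<k+l | s≤s l≤k =
            [ ⊥-elim ∘ ι≢0 (s≤s z≤n) k<p , id ]′ (integral (ι (suc k)) (f (suc k))
              (trans (sym (high k)) (•-vanish s (p ℕ.+ k) λ j _ p+k<j+l →
                above j (ℕ.+-cancelʳ-< (length s) p j
                  (ℕ.≤-<-trans (ℕ.+-monoʳ-≤ p l≤k) p+k<j+l)))))

          -- By `gap`, the coefficients of `s f` from index `p` on are those of `s`; by `high` they
          -- are those of `f′`.
          derivative≡s : ∀ n → derivative f n ≡ (s • 1ˢ) n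
          derivative≡s n = trans (sym (high n)) (•-monic lead above s gap n)

          -- The polynomial `f + x − xᵖ`. The factor `1#` gives each sum the form that `•-+*`
          -- expects.
          h : Series
          h n = (f n + 1# * shift 1ˢ n) + -1# * shiftBy p 1ˢ n

          -- Replacing `s` by `f′` in `s x − s xᵖ` turns `s h` into the left side of the
          -- differential equation.
          s•h≡0 : ∀ n → (s • h) n ≡ 0#
          s•h≡0 n = begin
            (s • h) n
              ≡⟨ •-+* s (λ k → f k + 1# * shift 1ˢ k) -1# (shiftBy p 1ˢ) n ⟩
            (s • (λ k → f k + 1# * shift 1ˢ k)) n + -1# * (s • shiftBy p 1ˢ) n
              ≡⟨ cong₂ (λ u v → u + -1# * v) (•-+* s f 1# (shift 1ˢ) n) (•-shiftBy s p 1ˢ n) ⟩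
            ((s • f) n + 1# * (s • shift 1ˢ) n) + -1# * shiftBy p (s • 1ˢ) n
              ≡⟨ cong (λ u → ((s • f) n + 1# * u) + -1# * shiftBy p (s • 1ˢ) n) (•-shift s 1ˢ n) ⟩
            ((s • f) n + 1# * shift (s • 1ˢ) n) + -1# * shiftBy p (s • 1ˢ) n
              ≡⟨ cong₂ (λ u v → ((s • f) n + 1# * u) + -1# * v)
                   (sym (shift-cong derivative≡s n)) (sym (shiftBy-cong p derivative≡s n)) ⟩
            ((s • f) n + 1# * shift (derivative f) n) + -1# * shiftBy p (derivative f) n
              ≡⟨ solve 3 (λ u v w → (u :+ con 1 :* v) :+ w := u :+ (v :+ w)) refl
                   ((s • f) n) (shift (derivative f) n) (-1# * shiftBy p (derivative f) n) ⟩
            (s • f) n + (shift (derivative f) n + -1# * shiftBy p (derivative f) n)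
              ≡⟨ annihilates′ n ⟩
            0# ∎
            where open ≡-Reasoning

          -- If `h` vanishes, then `f = xᵖ − x`, whose derivative is the constant -1.
          ι*f≡0 : (∀ n → h n ≡ 0#) → ∀ n → derivative f (suc n) ≡ 0#
          ι*f≡0 h≡0 n with ℕ.<-cmp (suc (suc n)) p
          ... | tri≈ _ refl _ = trans (cong (_* f p) ιp≡0) (solve 1 (λ u → con 0 :* u := con 0) refl (f p))
          ... | tri> _ _ p<n = trans (cong (ι (suc (suc n)) *_) (above _ p<n))
            (solve 1 (λ u → u :* con 0 := con 0) refl (ι (suc (suc n))))
          ... | tri< n<p _ _ = trans (cong (ι (suc (suc n)) *_) f≡0)
            (solve 1 (λ u → u :* con 0 := con 0) refl (ι (suc (suc n))))
            where
            -- Strictly between the indices 1 and `p`, neither `x` nor `xᵖ` contributes to `h`.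
            f≡0 : f (suc (suc n)) ≡ 0#
            f≡0 = trans
              (solve 2 (λ ν u → u := (u :+ con 1 :* con 0) :+ ν :* con 0) refl -1# (f (suc (suc n))))
              (trans (cong (λ u → (f (suc (suc n)) + 1# * 0#) + -1# * u) (sym (shiftBy-< 1ˢ n<p)))
                (h≡0 (suc (suc n))))

        annihilator-constant : ∃[ c ] ∀ x → eval s x ≡ c
        annihilator-constant with •-integral s h s•h≡0
        ... | inj₁ s≡0 = 0# , eval-zero s≡0
        ... | inj₂ h≡0 = eval-constant s λ n → trans (sym (derivative≡s (suc n))) (ι*f≡0 h≡0 n)

      -- `s + (x − xᵖ) f′ / f` has degree below `p` and vanishes at the `p` points `e i`, so all its
      -- coefficients are zero. Multiplied by `f`, this is the differential equation.
      small-degree-constant :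
        ∀ s (w : Fin p → ℕ) (e : Fin p → F) → (∀ {i j} → e i ≡ e j → i ≡ j) →
        length s ℕ.+ length s < p → sum w ≡ p → (∀ i → ι (w i) + eval s (e i) ≡ 0#) →
        ∃[ c ] ∀ x → eval s x ≡ c
      small-degree-constant s w e inj 2l<p sum≡p root =
        annihilator-constant s as 2l<p (trans (length-multiset w e) sum≡p)
          λ n → trans (sym (⊞δ-• s as n)) (•-zero vanishing (monicProduct as) n)
        where
        as : List F
        as = multiset w e
        vanishing : All (_≡ 0#) (s ⊞δ as)
        vanishing = roots-zero (s ⊞δ as) e inj
          (λ i → trans (eval-⊞δ-multiset s w e inj i) (root i))
          (length-⊞δ s as (ℕ.≤-trans (ℕ.m≤m+n _ _) (ℕ.<⇒≤ 2l<p)))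

-- Additivity of the Frobenius map.

-- `p` divides `p !`, the product of `p C k`, `k !` and `(p ∸ k) !`, but divides no factorial of a
-- smaller number; Euclid's lemma leaves the binomial coefficient.
nonconstant-binomial-divisible : ∀ {p k} → Prime p → 0 < k → k < p → p ∣ p C k
nonconstant-binomial-divisible {p} {k} p-prime 0<k k<p =
  [ id , ⊥-elim ∘ [ ∤! k<p , ∤! (ℕ.∸-monoʳ-< 0<k k≤p) ]′ ∘ euclidsLemma (k !) ((p ∸ k) !) p-prime ]′
    (euclidsLemma (p C k) (k ! ℕ.* (p ∸ k) !) p-prime
      (subst (p ∣_) (sym pCk*d≡p!) (∣! (ℕ.<-≤-trans 0<k k≤p))))
  where
  k≤p = ℕ.<⇒≤ k<p
  instance
    _ = k ℕ.!* (p ∸ k) !≢0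

  pCk*d≡p! : (p C k) ℕ.* (k ! ℕ.* (p ∸ k) !) ≡ p !
  pCk*d≡p! = trans (cong (ℕ._* (k ! ℕ.* (p ∸ k) !)) (nCk≡n!/k![n-k]! k≤p)) (m/n*n≡m (k![n∸k]!∣n! k≤p))

  ∣! : ∀ {n} → 0 < n → n ∣ n !
  ∣! {suc n} _ = m∣m*n (n !)

  ∤! : ∀ {n} → n < p → p ∤ n !
  ∤! {zero}  0<p p∣1 = ¬prime[1] (subst Prime (∣1⇒≡1 p∣1) p-prime)
  ∤! {suc n} n<p p∣n! with euclidsLemma (suc n) (n !) p-prime p∣n!
  ... | inj₁ p∣n  = >⇒∤ n<p p∣n
  ... | inj₂ p∣n!′ = ∤! (ℕ.<-trans (ℕ.n<1+n n) n<p) p∣n!′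

module _ {c ℓ} (R : CommutativeSemiring c ℓ) where
  open CommutativeSemiring R
    using (Carrier; _≈_; _+_; _*_; 0#; +-cong; +-congˡ; +-comm; +-identityˡ;
           *-identityˡ; *-identityʳ; +-monoid; semiring; setoid)
  private module ≈ = CommutativeSemiring R
  open import Algebra.Properties.CommutativeSemiring.Binomial R using (binomialTerm; theorem)
  open import Algebra.Properties.Monoid.Mult +-monoid using (_×_; ×-assocˡ; ×-homo-1)
  open import Algebra.Properties.Monoid.Sum +-monoid
    using (sum-cong-≋; sum-init-last; sum-replicate-zero) renaming (sum to ∑)
  open import Algebra.Properties.Semiring.Exp semiring using (_^_)
  open import Relation.Binary.Reasoning.Setoid setoid

  frobenius-+ : ∀ {p} → Prime p → (∀ x → p × x ≈ 0#) → ∀ x y → (x + y) ^ p ≈ x ^ p + y ^ p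
  frobenius-+ {zero}  p-prime p×≈0 x y = ⊥-elim (¬prime[0] p-prime)
  frobenius-+ {suc q} p-prime p×≈0 x y = begin
    (x + y) ^ p                           ≈⟨ theorem p x y ⟩
    -- The term of index `k` contains `x ^ k`, so the first term is `y ^ p` and the last is `x ^ p`.
    -- The terms between them are multiples of `p`.
    t zero + ∑ (t ∘ suc)                  ≈⟨ +-cong first (sum-init-last (t ∘ suc)) ⟩
    y ^ p + (∑ middle + t (fromℕ p))      ≈⟨ +-congˡ (+-cong middle≈0 last≈) ⟩
    y ^ p + (0# + x ^ p)                  ≈⟨ +-congˡ (+-identityˡ _) ⟩
    y ^ p + x ^ p                         ≈⟨ +-comm _ _ ⟩
    x ^ p + y ^ p                         ∎
    where
    p = suc q
    t = binomialTerm x y p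
    middle : Fin q → Carrier
    middle i = t (suc (inject₁ i))

    first : t zero ≈ y ^ p
    first = ≈.trans (×-homo-1 _) (*-identityˡ _)

    last≈ : t (fromℕ p) ≈ x ^ p
    last≈ rewrite toℕ-fromℕ q | nCn≡1 p | ℕ.n∸n≡0 q = ≈.trans (×-homo-1 _) (*-identityʳ _)

    multiple≈0 : ∀ {n} z → p ∣ n → n × z ≈ 0#
    multiple≈0 {n} z (divides k eq) = begin
      n × z         ≡⟨ cong (_× z) (trans eq (ℕ.*-comm k p)) ⟩
      (p ℕ.* k) × z ≈⟨ ×-assocˡ z p k ⟨
      p × (k × z)   ≈⟨ p×≈0 (k × z) ⟩
      0#            ∎

    middle≈0 : ∑ middle ≈ 0#
    middle≈0 = ≈.trans
      (sum-cong-≋ λ i → multiple≈0 _ (nonconstant-binomial-divisible p-prime (s≤s z≤n)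
        (s≤s (subst (_< q) (sym (toℕ-inject₁ i)) (toℕ<n i)))))
      (sum-replicate-zero q)

-- The field of residues modulo `p`.

module PrimeField (p : ℕ) .{{_ : NonZero p}} (p-prime : Prime p) where
  open Defs using (𝔽; _+_; _*_; 0#)
  open ≡-Reasoning

  1# -1# : 𝔽 p
  1#  = 1 mod p
  -1# = (p ∸ 1) mod p

  toℕ-mod : ∀ m → toℕ (m mod p) ≡ m % p
  toℕ-mod m = toℕ-fromℕ< (m%n<n m p)

  mod-cong : ∀ {m n} → m % p ≡ n % p → m mod p ≡ n mod p
  mod-cong {m} {n} eq = toℕ-injective (trans (toℕ-mod m) (trans eq (sym (toℕ-mod n))))

  mod-toℕ : ∀ (x : 𝔽 p) → toℕ x mod p ≡ x
  mod-toℕ x = toℕ-injective (trans (toℕ-mod (toℕ x)) (m<n⇒m%n≡m (toℕ<n x)))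

  mod-+ : ∀ m n → (m mod p) + (n mod p) ≡ (m ℕ.+ n) mod p
  mod-+ m n = mod-cong (trans (cong₂ (λ u v → (u ℕ.+ v) % p) (toℕ-mod m) (toℕ-mod n))
                              (sym (%-distribˡ-+ m n p)))

  mod-* : ∀ m n → (m mod p) * (n mod p) ≡ (m ℕ.* n) mod p
  mod-* m n = mod-cong (trans (cong₂ (λ u v → (u ℕ.* v) % p) (toℕ-mod m) (toℕ-mod n))
                              (sym (%-distribˡ-* m n p)))

  -- A reduction in one operand is absorbed by the reduction of the result. Thus the laws for
  -- residues come from those of `ℕ`, once commutativity has brought the reduced operand to the
  -- right.
  +-mod : ∀ x n → x + (n mod p) ≡ (toℕ x ℕ.+ n) mod p
  +-mod x n = trans (cong (_+ (n mod p)) (sym (mod-toℕ x))) (mod-+ (toℕ x) n)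

  *-mod : ∀ x n → x * (n mod p) ≡ (toℕ x ℕ.* n) mod p
  *-mod x n = trans (cong (_* (n mod p)) (sym (mod-toℕ x))) (mod-* (toℕ x) n)

  +-comm : ∀ (x y : 𝔽 p) → x + y ≡ y + x
  +-comm x y = cong (_mod p) (ℕ.+-comm (toℕ x) (toℕ y))

  *-comm : ∀ (x y : 𝔽 p) → x * y ≡ y * x
  *-comm x y = cong (_mod p) (ℕ.*-comm (toℕ x) (toℕ y))

  +-assoc : ∀ (x y z : 𝔽 p) → (x + y) + z ≡ x + (y + z)
  +-assoc x y z = begin
    (x + y) + z                             ≡⟨ +-comm (x + y) z ⟩
    z + (x + y)                             ≡⟨ +-mod z (toℕ x ℕ.+ toℕ y) ⟩
    (toℕ z ℕ.+ (toℕ x ℕ.+ toℕ y)) mod p     ≡⟨ cong (_mod p) (ℕ.+-comm (toℕ z) _) ⟩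
    ((toℕ x ℕ.+ toℕ y) ℕ.+ toℕ z) mod p     ≡⟨ cong (_mod p) (ℕ.+-assoc (toℕ x) (toℕ y) (toℕ z)) ⟩
    (toℕ x ℕ.+ (toℕ y ℕ.+ toℕ z)) mod p     ≡⟨ sym (+-mod x (toℕ y ℕ.+ toℕ z)) ⟩
    x + (y + z)                             ∎

  *-assoc : ∀ (x y z : 𝔽 p) → (x * y) * z ≡ x * (y * z)
  *-assoc x y z = begin
    (x * y) * z                             ≡⟨ *-comm (x * y) z ⟩
    z * (x * y)                             ≡⟨ *-mod z (toℕ x ℕ.* toℕ y) ⟩
    (toℕ z ℕ.* (toℕ x ℕ.* toℕ y)) mod p     ≡⟨ cong (_mod p) (ℕ.*-comm (toℕ z) _) ⟩
    ((toℕ x ℕ.* toℕ y) ℕ.* toℕ z) mod p     ≡⟨ cong (_mod p) (ℕ.*-assoc (toℕ x) (toℕ y) (toℕ z)) ⟩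
    (toℕ x ℕ.* (toℕ y ℕ.* toℕ z)) mod p     ≡⟨ sym (*-mod x (toℕ y ℕ.* toℕ z)) ⟩
    x * (y * z)                             ∎

  *-distribˡ-+ : ∀ (x y z : 𝔽 p) → x * (y + z) ≡ x * y + x * z
  *-distribˡ-+ x y z = begin
    x * (y + z)                                    ≡⟨ *-mod x (toℕ y ℕ.+ toℕ z) ⟩
    (toℕ x ℕ.* (toℕ y ℕ.+ toℕ z)) mod p            ≡⟨ cong (_mod p) (ℕ.*-distribˡ-+ (toℕ x) (toℕ y) (toℕ z)) ⟩
    (toℕ x ℕ.* toℕ y ℕ.+ toℕ x ℕ.* toℕ z) mod p    ≡⟨ sym (mod-+ (toℕ x ℕ.* toℕ y) (toℕ x ℕ.* toℕ z)) ⟩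
    x * y + x * z                                  ∎

  *-distribʳ-+ : ∀ (x y z : 𝔽 p) → (y + z) * x ≡ y * x + z * x
  *-distribʳ-+ x y z = begin
    (y + z) * x   ≡⟨ *-comm (y + z) x ⟩
    x * (y + z)   ≡⟨ *-distribˡ-+ x y z ⟩
    x * y + x * z ≡⟨ cong₂ _+_ (*-comm x y) (*-comm x z) ⟩
    y * x + z * x ∎

  +-identityʳ : ∀ (x : 𝔽 p) → x + 0# ≡ x
  +-identityʳ x = trans (+-mod x 0) (trans (cong (_mod p) (ℕ.+-identityʳ (toℕ x))) (mod-toℕ x))

  *-identityʳ : ∀ (x : 𝔽 p) → x * 1# ≡ x
  *-identityʳ x = trans (*-mod x 1) (trans (cong (_mod p) (ℕ.*-identityʳ (toℕ x))) (mod-toℕ x))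

  *-zeroʳ : ∀ (x : 𝔽 p) → x * 0# ≡ 0#
  *-zeroʳ x = trans (*-mod x 0) (cong (_mod p) (ℕ.*-zeroʳ (toℕ x)))

  isCommutativeSemiring : IsCommutativeSemiring {A = 𝔽 p} _≡_ _+_ _*_ 0# 1#
  isCommutativeSemiring = record
    { isSemiring = record
      { isSemiringWithoutAnnihilatingZero = record
        { +-isCommutativeMonoid = record
          { isMonoid = record
            { isSemigroup = record
              { isMagma = record { isEquivalence = isEquivalence ; ∙-cong = cong₂ _+_ }
              ; assoc   = +-assoc
              }
            ; identity = (λ x → trans (+-comm 0# x) (+-identityʳ x)) , +-identityʳ
            }
          ; comm = +-comm
          }
        ; *-cong     = cong₂ _*_
        ; *-assoc    = *-assoc
        ; *-identity = (λ x → trans (*-comm 1# x) (*-identityʳ x)) , *-identityʳ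
        ; distrib    = *-distribˡ-+ , *-distribʳ-+
        }
      ; zero = (λ x → trans (*-comm 0# x) (*-zeroʳ x)) , *-zeroʳ
      }
    ; *-comm = *-comm
    }

  commutativeSemiring : CommutativeSemiring _ _
  commutativeSemiring = record { isCommutativeSemiring = isCommutativeSemiring }

  open Polynomials isCommutativeSemiring public using (ι; _×_; _^_; eval; eval-zero; module IntegralDomain)

  ι≡mod : ∀ n → ι n ≡ n mod p
  ι≡mod zero    = refl
  ι≡mod (suc n) = trans (cong (1# +_) (ι≡mod n)) (mod-+ 1 n)

  p-mod-p : p mod p ≡ 0#
  p-mod-p = mod-cong (trans (n%n≡0 p) (sym (m*n%n≡0 0 p)))

  1+-1≡0 : 1# + -1# ≡ 0#
  1+-1≡0 = trans (mod-+ 1 (p ∸ 1)) (trans (cong (_mod p) (ℕ.suc-pred p)) p-mod-p)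

  mod≡0⇒∣ : ∀ n → n mod p ≡ 0# → p ∣ n
  mod≡0⇒∣ n eq = m%n≡0⇒n∣m n p (begin
    n % p         ≡⟨ sym (toℕ-mod n) ⟩
    toℕ (n mod p) ≡⟨ cong toℕ eq ⟩
    toℕ (0 mod p) ≡⟨ toℕ-mod 0 ⟩
    0 % p         ≡⟨ m*n%n≡0 0 p ⟩
    0             ∎)

  integral : ∀ (x y : 𝔽 p) → x * y ≡ 0# → x ≡ 0# ⊎ y ≡ 0#
  integral x y xy≡0 =
    Sum.map (∣⇒≡0 x) (∣⇒≡0 y) (euclidsLemma (toℕ x) (toℕ y) p-prime (mod≡0⇒∣ _ xy≡0))
    where
    ∣⇒≡0 : ∀ (x : 𝔽 p) → p ∣ toℕ x → x ≡ 0#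
    ∣⇒≡0 x p∣x = trans (sym (mod-toℕ x))
      (mod-cong (trans (n∣m⇒m%n≡0 (toℕ x) p p∣x) (sym (m*n%n≡0 0 p))))

  ιp≡0 : ι p ≡ 0#
  ιp≡0 = trans (ι≡mod p) p-mod-p

  ι≢0 : ∀ {k} → 0 < k → k < p → ι k ≢ 0#
  ι≢0 {suc k} _ k<p ιk≡0 = >⇒∤ k<p (mod≡0⇒∣ (suc k) (trans (sym (ι≡mod (suc k))) ιk≡0))

  p×≡0 : ∀ x → p × x ≡ 0#
  p×≡0 x = begin
    p × x        ≡⟨ cong (p ×_) (sym (trans (*-comm 1# x) (*-identityʳ x))) ⟩
    p × (1# * x) ≡⟨ sym (×-assoc-* p 1# x) ⟩
    ι p * x      ≡⟨ cong (_* x) ιp≡0 ⟩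
    0# * x       ≡⟨ trans (*-comm 0# x) (*-zeroʳ x) ⟩
    0#           ∎
    where open import Algebra.Properties.Semiring.Mult
                        (CommutativeSemiring.semiring commutativeSemiring) using (×-assoc-*)

  -- Every residue is `ι n` for its representative `n`; induction on `n` by additivity of the `p`-th
  -- power.
  fermat : ∀ x → x ^ p ≡ x
  fermat x = subst (λ y → y ^ p ≡ y) (trans (ι≡mod (toℕ x)) (mod-toℕ x)) (fermat-ι (toℕ x))
    where
    1^ : ∀ n → 1# ^ n ≡ 1#
    1^ zero    = refl
    1^ (suc n) = trans (cong (1# *_) (1^ n)) (*-identityʳ 1#)

    0^ : ∀ n → .{{NonZero n}} → 0# ^ n ≡ 0#
    0^ (suc n) = trans (*-comm 0# (0# ^ n)) (*-zeroʳ (0# ^ n))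

    fermat-ι : ∀ n → ι n ^ p ≡ ι n
    fermat-ι zero    = 0^ p
    fermat-ι (suc n) = trans (frobenius-+ commutativeSemiring p-prime p×≡0 1# (ι n))
                             (cong₂ _+_ (1^ p) (fermat-ι n))

  open IntegralDomain -1# 1+-1≡0 Fin._≟_ integral public

  eval≡⟦⟧ : ∀ g x → eval g x ≡ ⟦ g ⟧ x
  eval≡⟦⟧ []       x = refl
  eval≡⟦⟧ (c ∷ cs) x = cong (λ u → c + x * u) (eval≡⟦⟧ cs x)

  eval-map-* : ∀ b g x → eval (map (b *_) g) x ≡ b * eval g x
  eval-map-* b []       x = sym (*-zeroʳ b)
  eval-map-* b (c ∷ cs) x = begin
    b * c + x * eval (map (b *_) cs) x ≡⟨ cong (λ u → b * c + x * u) (eval-map-* b cs x) ⟩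
    b * c + x * (b * eval cs x)        ≡⟨ cong (b * c +_) (sym (*-assoc x b _)) ⟩
    b * c + (x * b) * eval cs x        ≡⟨ cong (λ u → b * c + u * eval cs x) (*-comm x b) ⟩
    b * c + (b * x) * eval cs x        ≡⟨ cong (b * c +_) (*-assoc b x _) ⟩
    b * c + b * (x * eval cs x)        ≡⟨ sym (*-distribˡ-+ b c _) ⟩
    b * (c + x * eval cs x)            ∎

  -- Only zero coefficients are cut off. The bounds on `s` are stated by `length`, so trailing zeros
  -- have to go.
  eval-take-degree : ∀ g x → eval (take (suc (degree g)) g) x ≡ eval g x
  eval-take-degree []       x = refl
  eval-take-degree (c ∷ cs) x with all? (Fin._≟ 0#) cs
  ... | yes cs≡0 = cong (λ u → c + x * u) (sym (eval-zero cs≡0 x))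
  ... | no  _    = cong (λ u → c + x * u) (eval-take-degree cs x)

theorem1p2 : (p : ℕ) .{{_ : NonZero p}} → Prime p → 2 ∤ p →
    (g : Polynomial p) → degree g ≤ p ∸ 1 →
    valueSum ⟦ g ⟧ ≡ p →
    ((p ∸ 1) / 2 ≤ degree g) ⊎ IsConstant ⟦ g ⟧
theorem1p2 0 p-prime = ⊥-elim (¬prime[0] p-prime)
theorem1p2 1 p-prime = ⊥-elim (¬prime[1] p-prime)
theorem1p2 p@(suc (suc m)) p-prime _ g _ sum≡p with (p ∸ 1) / 2 ℕ.≤? degree g
... | yes large = inj₁ large
... | no  small = inj₂ (negate constant)
  where
  open PrimeField p p-prime
  open PrimeOrder m ιp≡0 ι≢0 fermat using (small-degree-constant)
  s = map (-1# Defs.*_) (take (suc (degree g)) g)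

  eval-s : ∀ x → eval s x ≡ -1# Defs.* ⟦ g ⟧ x
  eval-s x = trans (eval-map-* -1# (take (suc (degree g)) g) x)
    (cong (-1# Defs.*_) (trans (eval-take-degree g x) (eval≡⟦⟧ g x)))

  length-s : length s ≤ suc (degree g)
  length-s = ℕ.≤-trans
    (ℕ.≤-reflexive (trans (length-map (-1# Defs.*_) (take (suc (degree g)) g)) (length-take (suc (degree g)) g)))
    (ℕ.m⊓n≤m _ _)

  2l<p : length s ℕ.+ length s < p
  -- `small` gives `degree g < h`, so `length s ≤ degree g + 1 ≤ h`, and twice `h` is at most
  -- `p ∸ 1`.
  2l<p = s≤s (ℕ.≤-trans (ℕ.+-mono-≤ l≤ l≤) (subst (_≤ p ∸ 1) (double h) (m/n*n≤m (p ∸ 1) 2)))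
    where
    h = (p ∸ 1) / 2
    l≤ : length s ≤ h
    l≤ = ℕ.≤-trans length-s (ℕ.≰⇒> small)
    double : ∀ n → n ℕ.* 2 ≡ n ℕ.+ n
    double n = trans (ℕ.*-comm n 2) (cong (n ℕ.+_) (ℕ.+-identityʳ n))

  root : ∀ x → ι (toℕ (⟦ g ⟧ x)) Defs.+ eval s x ≡ Defs.0#
  root x = trans
    (cong₂ Defs._+_ (trans (ι≡mod (toℕ (⟦ g ⟧ x))) (mod-toℕ (⟦ g ⟧ x))) (eval-s x))
    (+-inverse (⟦ g ⟧ x))

  constant : IsConstant (eval s)
  -- The points are all the residues, and the multiplicity of `x` is the integer representative of
  -- its value under `g`; `sum≡p` then says that the product has degree `p`.
  constant = small-degree-constant s (λ x → toℕ (⟦ g ⟧ x)) id id 2l<p sum≡p root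

  negate : IsConstant (eval s) → IsConstant ⟦ g ⟧
  -- The value at 0 is the witness: `−g(0) = c = −g(x)`, and adding `g(x)` gives `g(x) − g(0) = 0`.
  negate (c , eval≡c) = ⟦ g ⟧ Defs.0# , λ x → difference-zero _ _ (trans
    (cong (⟦ g ⟧ x Defs.+_) (trans (sym (eval-s Defs.0#)) (trans (eval≡c Defs.0#)
      (trans (sym (eval≡c x)) (eval-s x)))))
    (+-inverse (⟦ g ⟧ x)))
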